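{- Let $\Phi=\{4321,\,34512,\,45123,\,35412,\,43512,\,45132,\,45213,\,53412,\,45312,\,45231\}$. Let $w$ be a permutation. If $w$ avoids every pattern in $\Phi$, then $\mathrm{rep}(w)=[321;3412](w)$. Otherwise, $\mathrm{rep}(w)<[321;3412](w)$.
   Context: Permutations $w\in\mathfrak{S}_n$ are written in one-line notation $w(1)w(2)\cdots w(n)$. For $1\le i\le n-1$, $s_i$ denotes the simple reflection (adjacent transposition) interchanging $i$ and $i+1$. The length $\ell(w)$ is the minimal number of simple reflections in an expression $w=s_{i_1}\cdots s_{i_\ell}$; such a minimal expression is a reduced decomposition. The support $\mathrm{supp}(w)$ is the set of distinct simple reflections appearing in a reduced decomposition of $w$ (this is independent of the reduced decomposition chosen). Define $\mathrm{rep}(w)=\ell(w)-|\mathrm{supp}(w)|$. For $p\in\mathfrak{S}_k$, $k\le n$, an occurrence of the pattern $p$ in $w$ is a subsequence $w(i_1)\cdots w(i_k)$ with $i_1<\cdots<i_k$ in the same relative order as $p(1)\cdots p(k)$; $w$ contains $p$ if it has an occurrence of $p$ and avoids $p$ otherwise. $[321;3412](w)$ denotes the number of occurrences of $321$ in $w$ plus the number of occurrences of $3412$ in $w$. -}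

module Defs where

open import Data.Nat using (ℕ; zero; suc; _∸_; _≤_; _<_; _<ᵇ_)
open import Data.Nat.Properties using (_≟_)
open import Data.Bool using (Bool; true; false; _∧_; _∨_; not; if_then_else_)
open import Data.Fin using (Fin; toℕ)
open import Data.Vec using (Vec; toList)
open import Data.List using (List; []; _∷_; length; map; foldl; upTo; deduplicate; filter; _++_)
open import Data.List.Relation.Unary.All using (All)
open import Data.Product using (Σ; _×_)
open import Relation.Binary.PropositionalEquality using (_≡_)
open import Function using (_∘_)
open import Relation.Nullary.Decidable using (T?)

oneLine : ∀ {n} → Vec (Fin n) n → List ℕ
oneLine w = map (suc ∘ toℕ) (toList w)

IsPerm : ∀ {n} → Vec (Fin n) n → Set
IsPerm {n} w = ∀ (i j : Fin n) → Data.Vec.lookup w i ≡ Data.Vec.lookup w j → i ≡ j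

idLine : ℕ → List ℕ
idLine n = map suc (upTo n)

-- right multiplication by s_i (1-based): swap entries in positions i and i+1
swapAt : ℕ → List ℕ → List ℕ
swapAt zero xs = xs
swapAt (suc zero) (x ∷ y ∷ r) = y ∷ x ∷ r
swapAt (suc zero) xs = xs
swapAt (suc (suc k)) [] = []
swapAt (suc (suc k)) (x ∷ r) = x ∷ swapAt (suc k) r

-- a word in simple reflections of S_n: list of indices i with 1 ≤ i ≤ n-1
ValidWord : ℕ → List ℕ → Set
ValidWord n ws = All (λ i → 1 ≤ i × suc i ≤ n) ws

prod : ℕ → List ℕ → List ℕ
prod n ws = foldl (λ v i → swapAt i v) (idLine n) ws

IsExpr : ∀ {n} → Vec (Fin n) n → List ℕ → Set
IsExpr {n} w ws = ValidWord n ws × prod n ws ≡ oneLine w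

IsReduced : ∀ {n} → Vec (Fin n) n → List ℕ → Set
IsReduced {n} w ws = IsExpr w ws × (∀ vs → IsExpr w vs → length ws ≤ length vs)

-- for a reduced decomposition r of w: ℓ(w) = length r, |supp(w)| = number
-- of distinct letters of r, rep(w) = ℓ(w) - |supp(w)|
repVia : List ℕ → ℕ
repVia r = length r ∸ length (deduplicate _≟_ r)

subseqs : List ℕ → List (List ℕ)
subseqs [] = [] ∷ []
subseqs (x ∷ xs) = map (x ∷_) (subseqs xs) ++ subseqs xs

eqB : Bool → Bool → Bool
eqB true b = b
eqB false b = not b

sameOrder : List ℕ → List ℕ → Bool
sameOrder [] [] = true
sameOrder (x ∷ xs) (y ∷ ys) =
  pairs x xs y ys ∧ sameOrder xs ys
  where
  pairs : ℕ → List ℕ → ℕ → List ℕ → Bool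
  pairs x [] y [] = true
  pairs x (a ∷ as) y (b ∷ bs) = eqB (x <ᵇ a) (y <ᵇ b) ∧ pairs x as y bs
  pairs _ _ _ _ = false
sameOrder _ _ = false

occ : List ℕ → ∀ {n} → Vec (Fin n) n → ℕ
occ p w = length (filter (λ s → T? (sameOrder p s)) (subseqs (oneLine w)))

Avoids : List ℕ → ∀ {n} → Vec (Fin n) n → Set
Avoids p w = occ p w ≡ 0

count321-3412 : ∀ {n} → Vec (Fin n) n → ℕ
count321-3412 w = occ (3 ∷ 2 ∷ 1 ∷ []) w Data.Nat.+ occ (3 ∷ 4 ∷ 1 ∷ 2 ∷ []) w

Φ : List (List ℕ)
Φ = (4 ∷ 3 ∷ 2 ∷ 1 ∷ [])
  ∷ (3 ∷ 4 ∷ 5 ∷ 1 ∷ 2 ∷ [])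
  ∷ (4 ∷ 5 ∷ 1 ∷ 2 ∷ 3 ∷ [])
  ∷ (3 ∷ 5 ∷ 4 ∷ 1 ∷ 2 ∷ [])
  ∷ (4 ∷ 3 ∷ 5 ∷ 1 ∷ 2 ∷ [])
  ∷ (4 ∷ 5 ∷ 1 ∷ 3 ∷ 2 ∷ [])
  ∷ (4 ∷ 5 ∷ 2 ∷ 1 ∷ 3 ∷ [])
  ∷ (5 ∷ 3 ∷ 4 ∷ 1 ∷ 2 ∷ [])
  ∷ (4 ∷ 5 ∷ 3 ∷ 1 ∷ 2 ∷ [])
  ∷ (4 ∷ 5 ∷ 2 ∷ 3 ∷ 1 ∷ [])
  ∷ []

{-# OPTIONS --safe #-}

-- Peel off the first entry x of a permutation. The letters of a reduced word are the positions
-- crossed by an inversion. The numbers of inversions, of crossed positions, of 321s and of 3412s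
-- change by amounts depending only on x and the remaining entries, and a second induction turns
-- [321;3412] − (inversions − crossed positions) into a sum of natural numbers. The summand of x is
-- positive exactly when x starts a configuration of one of these kinds: a 43 which is followed
-- either by 21 or by an entry above the 3 and then two entries below it; an entry followed by two
-- larger ones and then by an ascent below it; an entry followed by a larger one and then by three
-- smaller ones. Up to passing to a subsequence these are the patterns of Φ.
module Submission where

open import Defs
open import Data.Nat
open import Data.Nat.Properties
open import Data.Nat.Tactic.RingSolver using (solve-∀)
open import Data.Bool using (Bool; true; false; _∧_; not; if_then_else_; T)
open import Data.Bool.Properties as Bool using (∧-zeroʳ)
open import Data.Fin using (Fin)
import Data.Fin.Properties as Fin
open import Data.Vec using (Vec; []; _∷_; toList; lookup)
open import Data.Vec.Properties using (length-toList)
open import Data.List using (List; []; _∷_; length; map; filter; upTo; applyUpTo; foldl; deduplicate; _++_)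
open import Data.List.Properties
  using (length-++; filter-++; length-map; map-upTo; foldl-∷ʳ; length-deduplicate)
open import Data.List.Membership.Propositional using (_∈_; lose)
open import Data.List.Membership.Propositional.Properties
  using (∈-map⁺; ∈-map⁻; ∈-filter⁺; ∈-filter⁻; ∈-upTo⁺; ∈-deduplicate⁺; ∈-deduplicate⁻)
open import Data.List.Membership.Propositional.Properties.WithK using (unique∧set⇒bag)
open import Data.List.Relation.Binary.BagAndSetEquality using (∼bag⇒↭)
open import Data.List.Relation.Binary.Permutation.Propositional
  using (_↭_; ↭-refl; ↭-sym; ↭-prep; ↭-swap; ↭⇒↭ₛ)
open import Data.List.Relation.Binary.Permutation.Propositional.Properties using (↭-length; All-resp-↭)
import Data.List.Relation.Binary.Permutation.Setoid.Properties as Permutation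
open import Data.List.Relation.Binary.Sublist.Propositional
  using (_⊆_; []; _∷_; _∷ʳ_; ⊆-refl; ⊆-trans; minimum)
open import Data.List.Relation.Unary.Any using (Any; here; there)
open import Data.List.Relation.Unary.All as All using (All; []; _∷_)
import Data.List.Relation.Unary.All.Properties as All
open import Data.List.Relation.Unary.AllPairs as AllPairs using (AllPairs; []; _∷_)
import Data.List.Relation.Unary.AllPairs.Properties as AllPairs
open import Data.List.Relation.Unary.Unique.Propositional using (Unique)
import Data.List.Relation.Unary.Unique.Propositional.Properties as Unique
open import Data.List.Relation.Unary.Unique.DecPropositional.Properties _≟_ using (deduplicate-!)
open import Data.Product using (∃-syntax; _×_; _,_; proj₁; proj₂)
open import Data.Sum using (_⊎_; inj₁; inj₂)
open import Data.Empty using (⊥-elim)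
open import Data.Unit using (⊤; tt)
open import Relation.Nullary using (¬_; yes; no; invert)
open import Relation.Nullary.Decidable using (T?)
open import Relation.Binary.PropositionalEquality
open import Function using (_∘_; id; mk⇔)

-- Boolean comparisons

χ : Bool → ℕ
χ true  = 1
χ false = 0

-- Abstracting `x <ᵇ y` together with `compareᵇ x y` makes functions that branch on the Boolean
-- reduce and supplies the inequality in the same match.
data Compare (x y : ℕ) : Bool → Set where
  lt : x < y → Compare x y true
  ge : y ≤ x → Compare x y false

compareᵇ : ∀ x y → Compare x y (x <ᵇ y)
compareᵇ x y with x <ᵇ y | <ᵇ-reflects-< x y
... | true  | r = lt (invert r)
... | false | r = ge (≮⇒≥ (invert r))

<⇒<ᵇ≡true : ∀ {x y} → x < y → (x <ᵇ y) ≡ true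
<⇒<ᵇ≡true {x} {y} x<y with x <ᵇ y | compareᵇ x y
... | true  | _ = refl
... | false | ge y≤x = ⊥-elim (<⇒≱ x<y y≤x)

≥⇒<ᵇ≡false : ∀ {x y} → y ≤ x → (x <ᵇ y) ≡ false
≥⇒<ᵇ≡false {x} {y} y≤x with x <ᵇ y | compareᵇ x y
... | true  | lt x<y = ⊥-elim (<⇒≱ x<y y≤x)
... | false | _ = refl

-- Counting subsequences

count : (List ℕ → Bool) → List ℕ → ℕ
count P xs = length (filter (λ s → T? (P s)) (subseqs xs))

length-filter-map : ∀ (P : List ℕ → Bool) x ss →
  length (filter (λ s → T? (P s)) (map (x ∷_) ss)) ≡ length (filter (λ s → T? (P (x ∷ s))) ss)
length-filter-map P x [] = refl
length-filter-map P x (s ∷ ss) with P (x ∷ s)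
... | true  = cong suc (length-filter-map P x ss)
... | false = length-filter-map P x ss

count-∷ : ∀ P x xs → count P (x ∷ xs) ≡ count (P ∘ (x ∷_)) xs + count P xs
count-∷ P x xs = begin
  length (filter P? (map (x ∷_) (subseqs xs) ++ subseqs xs))
    ≡⟨ cong length (filter-++ P? (map (x ∷_) (subseqs xs)) (subseqs xs)) ⟩
  length (filter P? (map (x ∷_) (subseqs xs)) ++ filter P? (subseqs xs))
    ≡⟨ length-++ (filter P? (map (x ∷_) (subseqs xs))) ⟩
  length (filter P? (map (x ∷_) (subseqs xs))) + count P xs
    ≡⟨ cong (_+ count P xs) (length-filter-map P x (subseqs xs)) ⟩
  count (P ∘ (x ∷_)) xs + count P xs ∎
  where
  open ≡-Reasoning
  P? = λ s → T? (P s)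

count-[] : ∀ P → count P [] ≡ χ (P [])
count-[] P with P []
... | true  = refl
... | false = refl

-- Stated through `χ`, a single pointwise equation says both that `P` and `Q` are disjoint and that
-- together they make up `R`.
count-+ : ∀ P Q R → (∀ s → χ (P s) + χ (Q s) ≡ χ (R s)) →
  ∀ xs → count P xs + count Q xs ≡ count R xs
count-+ P Q R eq [] rewrite count-[] P | count-[] Q | count-[] R = eq []
count-+ P Q R eq (x ∷ xs)
  rewrite count-∷ P x xs | count-∷ Q x xs | count-∷ R x xs
        | sym (count-+ (P ∘ (x ∷_)) (Q ∘ (x ∷_)) (R ∘ (x ∷_)) (eq ∘ (x ∷_)) xs)
        | sym (count-+ P Q R eq xs)
  = exchange (count (P ∘ (x ∷_)) xs) (count P xs) (count (Q ∘ (x ∷_)) xs) (count Q xs)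
  where
  exchange : ∀ a b c d → a + b + (c + d) ≡ a + c + (b + d)
  exchange = solve-∀

count-cong : ∀ {P Q} → (∀ s → P s ≡ Q s) → ∀ xs → count P xs ≡ count Q xs
count-cong {P} {Q} eq [] rewrite count-[] P | count-[] Q = cong χ (eq [])
count-cong {P} {Q} eq (x ∷ xs) rewrite count-∷ P x xs | count-∷ Q x xs =
  cong₂ _+_ (count-cong (eq ∘ (x ∷_)) xs) (count-cong eq xs)

count-false : ∀ {P} → (∀ s → P s ≡ false) → ∀ xs → count P xs ≡ 0
count-false {P} eq [] rewrite count-[] P | eq [] = refl
count-false {P} eq (x ∷ xs) rewrite count-∷ P x xs =
  cong₂ _+_ (count-false (eq ∘ (x ∷_)) xs) (count-false eq xs)

count-∷-cong : ∀ {P Q x} → (∀ s → P (x ∷ s) ≡ Q s) → ∀ xs →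
  count P (x ∷ xs) ≡ count Q xs + count P xs
count-∷-cong {P} {Q} {x} eq xs =
  trans (count-∷ P x xs) (cong (_+ count P xs) (count-cong eq xs))

count-∷-false : ∀ {P x} → (∀ s → P (x ∷ s) ≡ false) → ∀ xs → count P (x ∷ xs) ≡ count P xs
count-∷-false {P} {x} eq xs =
  trans (count-∷ P x xs) (cong (_+ count P xs) (count-false eq xs))

count>0 : ∀ {s xs} P → s ⊆ xs → T (P s) → 0 < count P xs
count>0 P [] p with P []
... | true = s≤s z≤n
count>0 {s} {x ∷ xs} P (.x ∷ʳ sub) p rewrite count-∷ P x xs =
  ≤-trans (count>0 P sub p) (m≤n+m _ _)
count>0 {s} {x ∷ xs} P (refl ∷ sub) p rewrite count-∷ P x xs =
  ≤-trans (count>0 (P ∘ (x ∷_)) sub p) (m≤m+n _ _)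

0<m+n : ∀ m {n} → 0 < m + n → 0 < m ⊎ 0 < n
0<m+n zero    0<n = inj₂ 0<n
0<m+n (suc m) _   = inj₁ (s≤s z≤n)

count>0⁻ : ∀ P xs → 0 < count P xs → ∃[ s ] s ⊆ xs × T (P s)
count>0⁻ P [] 0<c with P [] in eq
... | true = [] , [] , subst T (sym eq) tt
count>0⁻ P (x ∷ xs) 0<c with 0<m+n (count (P ∘ (x ∷_)) xs) (subst (0 <_) (count-∷ P x xs) 0<c)
... | inj₁ 0<c₁ = let s , sub , p = count>0⁻ (P ∘ (x ∷_)) xs 0<c₁ in x ∷ s , refl ∷ sub , p
... | inj₂ 0<c₂ = let s , sub , p = count>0⁻ P xs 0<c₂ in s , x ∷ʳ sub , p

-- The statistics and the excess

-- Ties count as inversions, as they do for sameOrder.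
below : ℕ → List ℕ → ℕ
below x []       = 0
below x (y ∷ ys) = if x <ᵇ y then below x ys else suc (below x ys)

inv : List ℕ → ℕ
inv []       = 0
inv (x ∷ xs) = below x xs + inv xs

-- The argument m stands for the largest entry to the left, so this counts the positions across
-- which some entry to the left, or m, exceeds an entry to the right.
crossings : ℕ → List ℕ → ℕ
crossings m []       = 0
crossings m (y ∷ ys) = χ (0 <ᵇ below m (y ∷ ys)) + crossings (m ⊔ y) ys

supportSize : List ℕ → ℕ
supportSize []       = 0
supportSize (x ∷ xs) = crossings x xs

pairsBelow : ℕ → List ℕ → ℕ
pairsBelow x = count (λ s → sameOrder (3 ∷ 2 ∷ 1 ∷ []) (x ∷ s))

count412 : ℕ → List ℕ → ℕ
count412 x = count (λ s → sameOrder (3 ∷ 4 ∷ 1 ∷ 2 ∷ []) (x ∷ s))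

choose₂ : ℕ → ℕ
choose₂ zero    = 0
choose₂ (suc d) = d + choose₂ d

-- The number of entries below x minus the number of indecomposable blocks containing one, in a
-- form without negative terms.
excessBelow : ℕ → List ℕ → ℕ
excessBelow x []       = 0
excessBelow x (y ∷ ys) =
  if x <ᵇ y then below x ys ∸ 1
  else excessBelow x ys + (crossings y ys ∸ supportSize ys)

-- The number of 321s and 3412s starting at `x`, minus the growth of (inversions - crossed
-- positions) when `x` is prepended; see `local-identity`. The recursion stops at the first entry
-- above `x`, which takes over as running maximum.
excessAt : ℕ → List ℕ → ℕ
excessAt x []       = 0
excessAt x (y ∷ ys) =
  if x <ᵇ y then count412 x ys + choose₂ (below x ys ∸ 1)
  else excessAt x ys + excessBelow y ys

excess : List ℕ → ℕ
excess []       = 0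
excess (x ∷ xs) = excess xs + excessAt x xs

-- The counting identity

below-mono : ∀ {m m′} → m ≤ m′ → ∀ ys → below m ys ≤ below m′ ys
below-mono m≤m′ [] = z≤n
below-mono {m} {m′} m≤m′ (y ∷ ys) with m <ᵇ y | compareᵇ m y | m′ <ᵇ y | compareᵇ m′ y
... | true  | _      | true  | _       = below-mono m≤m′ ys
... | true  | _      | false | _       = m≤n⇒m≤1+n (below-mono m≤m′ ys)
... | false | ge y≤m | true  | lt m′<y = ⊥-elim (<⇒≱ m′<y (≤-trans y≤m m≤m′))
... | false | _      | false | _       = s≤s (below-mono m≤m′ ys)

χ-pos-mono : ∀ {d d′} → d ≤ d′ → χ (0 <ᵇ d) ≤ χ (0 <ᵇ d′)
χ-pos-mono z≤n     = z≤n
χ-pos-mono (s≤s _) = s≤s z≤n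

crossings-mono : ∀ {m m′} → m ≤ m′ → ∀ ys → crossings m ys ≤ crossings m′ ys
crossings-mono m≤m′ [] = z≤n
crossings-mono m≤m′ (y ∷ ys) =
  +-mono-≤ (χ-pos-mono (below-mono m≤m′ (y ∷ ys))) (crossings-mono (⊔-monoˡ-≤ y m≤m′) ys)

supportSize≤crossings : ∀ y ys → supportSize ys ≤ crossings y ys
supportSize≤crossings y []       = z≤n
supportSize≤crossings y (z ∷ zs) = ≤-trans (crossings-mono (m≤n⊔m y z) zs) (m≤n+m _ _)

pos+pred : ∀ d → χ (0 <ᵇ d) + (d ∸ 1) ≡ d
pos+pred zero    = refl
pos+pred (suc d) = refl

-- Prepending `x` fuses the blocks of `xs` that contain an entry below `x`, and each of these blocks
-- adds one crossed position.
below+supportSize : ∀ x xs →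
  below x xs + supportSize xs ≡ crossings x xs + excessBelow x xs
below+supportSize x [] = refl
below+supportSize x (y ∷ ys) with x <ᵇ y | compareᵇ x y
-- All later entries below `x` are below `y` too, hence in the block of `y`. Together they account
-- for one new crossing, directly after `x`; the other `below x ys ∸ 1` are excess.
... | true | lt x<y rewrite m≤n⇒m⊔n≡n (<⇒≤ x<y) = begin
  below x ys + crossings y ys
    ≡⟨ cong (_+ crossings y ys) (pos+pred (below x ys)) ⟨
  χ (0 <ᵇ below x ys) + (below x ys ∸ 1) + crossings y ys
    ≡⟨ swap-last (χ (0 <ᵇ below x ys)) (below x ys ∸ 1) (crossings y ys) ⟩
  χ (0 <ᵇ below x ys) + crossings y ys + (below x ys ∸ 1) ∎
  where
  open ≡-Reasoning
  swap-last : ∀ a b c → a + b + c ≡ a + c + b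
  swap-last = solve-∀
... | false | ge y≤x rewrite m≥n⇒m⊔n≡m y≤x = cong suc (begin
  below x ys + crossings y ys
    -- `supportSize (y ∷ ys)` is `crossings y ys`. Splitting off `supportSize ys` exposes the
    -- induction hypothesis, and the truncated difference `δ` is exact because prepending `y`
    -- removes no crossing.
    ≡⟨ cong (below x ys +_) (m+[n∸m]≡n (supportSize≤crossings y ys)) ⟨
  below x ys + (supportSize ys + δ)
    ≡⟨ +-assoc (below x ys) (supportSize ys) δ ⟨
  below x ys + supportSize ys + δ
    ≡⟨ cong (_+ δ) (below+supportSize x ys) ⟩
  crossings x ys + excessBelow x ys + δ
    ≡⟨ +-assoc (crossings x ys) (excessBelow x ys) δ ⟩
  crossings x ys + (excessBelow x ys + δ) ∎)
  where
  open ≡-Reasoning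
  δ = crossings y ys ∸ supportSize ys

-- What remains of the pattern 321 once its first two entries are fixed and the second of them is
-- `x`.
isBelow : ℕ → List ℕ → Bool
isBelow x (a ∷ []) = not (x <ᵇ a)
isBelow x _        = false

isNil : List ℕ → Bool
isNil []      = true
isNil (_ ∷ _) = false

count-isNil : ∀ xs → count isNil xs ≡ 1
count-isNil []       = refl
count-isNil (x ∷ xs) = trans (count-∷-false {isNil} (λ _ → refl) xs) (count-isNil xs)

count-isBelow : ∀ x xs → count (isBelow x) xs ≡ below x xs
count-isBelow x [] = refl
count-isBelow x (y ∷ ys) with x <ᵇ y in eq
... | true  = trans (count-∷-false {isBelow x} (λ { [] → cong not eq ; (_ ∷ _) → refl }) ys)
                    (count-isBelow x ys)
... | false = trans (count-∷-cong {isBelow x} {isNil} (λ { [] → cong not eq ; (_ ∷ _) → refl }) ys)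
                    (cong₂ _+_ (count-isNil ys) (count-isBelow x ys))

areBelow : ℕ → List ℕ → Bool
areBelow x (a ∷ b ∷ []) = not (x <ᵇ a) ∧ not (x <ᵇ b)
areBelow x _            = false

count-areBelow : ∀ x xs → count (areBelow x) xs ≡ choose₂ (below x xs)
count-areBelow x [] = refl
count-areBelow x (y ∷ ys) with x <ᵇ y in eq
... | true  = trans (count-∷-false {areBelow x} head≡false ys) (count-areBelow x ys)
  where
  head≡false : ∀ s → areBelow x (y ∷ s) ≡ false
  head≡false []          = refl
  head≡false (b ∷ [])    = cong (λ t → not t ∧ not (x <ᵇ b)) eq
  head≡false (_ ∷ _ ∷ _) = refl
... | false = trans (count-∷-cong {areBelow x} {isBelow x} head≡isBelow ys)
                    (cong₂ _+_ (count-isBelow x ys) (count-areBelow x ys))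
  where
  head≡isBelow : ∀ s → areBelow x (y ∷ s) ≡ isBelow x s
  head≡isBelow []          = refl
  head≡isBelow (b ∷ [])    = cong (λ t → not t ∧ not (x <ᵇ b)) eq
  head≡isBelow (_ ∷ _ ∷ _) = refl

pairsBelow-∷≥ : ∀ {x y} → y ≤ x → ∀ ys → pairsBelow x (y ∷ ys) ≡ below y ys + pairsBelow x ys
pairsBelow-∷≥ {x} {y} y≤x ys =
  trans (count-∷-cong eq ys) (cong (_+ pairsBelow x ys) (count-isBelow y ys))
  where
  eq : ∀ s → sameOrder (3 ∷ 2 ∷ 1 ∷ []) (x ∷ y ∷ s) ≡ isBelow y s
  -- `sameOrder` compares entries before it meets a length mismatch, so the final `false` has to be
  -- pulled through the conjunctions.
  eq [] rewrite ∧-zeroʳ (not (x <ᵇ y)) = refl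
  eq (a ∷ []) rewrite ≥⇒<ᵇ≡false y≤x with y <ᵇ a | compareᵇ y a
  ... | true  | _ = ∧-zeroʳ _
  ... | false | ge a≤y rewrite ≥⇒<ᵇ≡false (≤-trans a≤y y≤x) = refl
  eq (a ∷ b ∷ s) rewrite ∧-zeroʳ (not (x <ᵇ a)) | ∧-zeroʳ (not (x <ᵇ y)) = refl

pairsBelow-∷< : ∀ {x y} → x < y → ∀ ys → pairsBelow x (y ∷ ys) ≡ pairsBelow x ys
pairsBelow-∷< {x} {y} x<y = count-∷-false eq
  where
  eq : ∀ s → sameOrder (3 ∷ 2 ∷ 1 ∷ []) (x ∷ y ∷ s) ≡ false
  eq s rewrite <⇒<ᵇ≡true x<y = refl

count412-∷≥ : ∀ {x y} → y ≤ x → ∀ ys → count412 x (y ∷ ys) ≡ count412 x ys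
count412-∷≥ {x} {y} y≤x = count-∷-false eq
  where
  eq : ∀ s → sameOrder (3 ∷ 4 ∷ 1 ∷ 2 ∷ []) (x ∷ y ∷ s) ≡ false
  eq s rewrite ≥⇒<ᵇ≡false y≤x = refl

-- An inversion below x completes x to a 321, a noninversion completes x y to a 3412.
count412-∷< : ∀ {x y} → x < y → ∀ ys →
  pairsBelow x ys + count412 x (y ∷ ys) ≡ choose₂ (below x ys) + count412 x ys
count412-∷< {x} {y} x<y ys = begin
  pairsBelow x ys + count412 x (y ∷ ys)
    ≡⟨ cong (pairsBelow x ys +_) (count-∷ (λ s → sameOrder (3 ∷ 4 ∷ 1 ∷ 2 ∷ []) (x ∷ s)) y ys) ⟩
  pairsBelow x ys + (ascending + count412 x ys)
    ≡⟨ +-assoc (pairsBelow x ys) ascending (count412 x ys) ⟨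
  pairsBelow x ys + ascending + count412 x ys
    ≡⟨ cong (_+ count412 x ys) (trans (count-+ _ _ (areBelow x) eq ys) (count-areBelow x ys)) ⟩
  choose₂ (below x ys) + count412 x ys ∎
  where
  open ≡-Reasoning
  ascending = count (λ s → sameOrder (3 ∷ 4 ∷ 1 ∷ 2 ∷ []) (x ∷ y ∷ s)) ys

  eq : ∀ s → χ (sameOrder (3 ∷ 2 ∷ 1 ∷ []) (x ∷ s))
           + χ (sameOrder (3 ∷ 4 ∷ 1 ∷ 2 ∷ []) (x ∷ y ∷ s)) ≡ χ (areBelow x s)
  eq [] rewrite <⇒<ᵇ≡true x<y = refl
  eq (a ∷ []) rewrite <⇒<ᵇ≡true x<y | ∧-zeroʳ (not (x <ᵇ a)) = refl
  eq (a ∷ b ∷ []) rewrite <⇒<ᵇ≡true x<y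
    with x <ᵇ a | compareᵇ x a | x <ᵇ b | compareᵇ x b
  ... | true  | _ | _    | _ = refl
  ... | false | _ | true | _ = refl
  ... | false | ge a≤x | false | ge b≤x
    rewrite ≥⇒<ᵇ≡false (≤-trans a≤x (<⇒≤ x<y)) | ≥⇒<ᵇ≡false (≤-trans b≤x (<⇒≤ x<y))
    with a <ᵇ b
  ... | true  = refl
  ... | false = refl
  eq (a ∷ b ∷ c ∷ s) rewrite <⇒<ᵇ≡true x<y
    | ∧-zeroʳ (not (x <ᵇ b)) | ∧-zeroʳ (not (x <ᵇ a)) = refl

-- For positive `d`, `choose₂ d` is `d ∸ 1` plus `choose₂ (d ∸ 1)`, and the crossing directly after
-- `x` supplies the missing unit.
choose₂-pred : ∀ d → choose₂ d + χ (0 <ᵇ d) ≡ d + choose₂ (d ∸ 1)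
choose₂-pred zero    = refl
choose₂-pred (suc d) = +-comm (d + choose₂ d) 1

local-identity : ∀ x xs →
  pairsBelow x xs + count412 x xs + crossings x xs ≡ below x xs + supportSize xs + excessAt x xs
local-identity x [] = refl
local-identity x (y ∷ ys) with x <ᵇ y | compareᵇ x y
-- Each pair of entries below `x` after `y` counts once: as a 321 with `x`, or as a 3412 with `x`
-- and `y`.
... | true | lt x<y rewrite m≤n⇒m⊔n≡n (<⇒≤ x<y) | pairsBelow-∷< x<y ys | count412-∷< x<y ys =
  trans (regroup₁ (choose₂ (below x ys)) (count412 x ys) (χ (0 <ᵇ below x ys)) (crossings y ys))
  (trans (cong (λ k → k + count412 x ys + crossings y ys) (choose₂-pred (below x ys)))
         (regroup₂ (below x ys) (choose₂ (below x ys ∸ 1)) (count412 x ys) (crossings y ys)))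
  where
  regroup₁ : ∀ a b c d → a + b + (c + d) ≡ a + c + b + d
  regroup₁ = solve-∀
  regroup₂ : ∀ a b c d → a + b + c + d ≡ a + d + (c + b)
  regroup₂ = solve-∀
-- The new 321s begin with `x y` and number `below y ys`. Applied to `y`, `below+supportSize` trades
-- them and `supportSize ys` for the support of `y ∷ ys` and the excess below `y`.
... | false | ge y≤x rewrite m≥n⇒m⊔n≡m y≤x | pairsBelow-∷≥ y≤x ys | count412-∷≥ y≤x ys =
  trans (regroup₁ (below y ys) (pairsBelow x ys) (count412 x ys) (crossings x ys))
  (trans (cong (λ k → suc (k + below y ys)) (local-identity x ys))
  (trans (regroup₂ (below x ys) (supportSize ys) (excessAt x ys) (below y ys))
  (trans (cong (λ k → suc (below x ys + excessAt x ys + k)) (below+supportSize y ys))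
         (regroup₃ (below x ys) (excessAt x ys) (crossings y ys) (excessBelow y ys)))))
  where
  regroup₁ : ∀ a b c d → a + b + c + (1 + d) ≡ suc (b + c + d + a)
  regroup₁ = solve-∀
  regroup₂ : ∀ a b c d → suc (a + b + c + d) ≡ suc (a + c + (d + b))
  regroup₂ = solve-∀
  regroup₃ : ∀ a b c d → suc (a + b + (c + d)) ≡ suc (a + c) + (b + d)
  regroup₃ = solve-∀

-- `local-identity` telescopes along the list, since `crossings x xs` is `supportSize (x ∷ xs)`.
count-identity : ∀ xs →
  count (sameOrder (3 ∷ 2 ∷ 1 ∷ [])) xs + count (sameOrder (3 ∷ 4 ∷ 1 ∷ 2 ∷ [])) xs + supportSize xs
    ≡ inv xs + excess xs
count-identity [] = refl
count-identity (x ∷ xs)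
  rewrite count-∷ (sameOrder (3 ∷ 2 ∷ 1 ∷ [])) x xs | count-∷ (sameOrder (3 ∷ 4 ∷ 1 ∷ 2 ∷ [])) x xs =
  trans (regroup₁ (pairsBelow x xs) t (count412 x xs) c (crossings x xs))
  (trans (cong (_+ (t + c)) (local-identity x xs))
  (trans (regroup₂ (below x xs) (supportSize xs) (excessAt x xs) t c)
  (trans (cong (below x xs + excessAt x xs +_) (count-identity xs))
         (regroup₃ (below x xs) (excessAt x xs) (inv xs) (excess xs)))))
  where
  t = count (sameOrder (3 ∷ 2 ∷ 1 ∷ [])) xs
  c = count (sameOrder (3 ∷ 4 ∷ 1 ∷ 2 ∷ [])) xs
  regroup₁ : ∀ a b c d e → a + b + (c + d) + e ≡ a + c + e + (b + d)
  regroup₁ = solve-∀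
  regroup₂ : ∀ a b c d e → a + b + c + (d + e) ≡ a + c + (d + e + b)
  regroup₂ = solve-∀
  regroup₃ : ∀ a b c d → a + b + (c + d) ≡ a + c + (d + b)
  regroup₃ = solve-∀

-- Reduced words and inversions

swapAt-↭ : ∀ j l → swapAt j l ↭ l
swapAt-↭ zero          l           = ↭-refl
swapAt-↭ (suc zero)    []          = ↭-refl
swapAt-↭ (suc zero)    (x ∷ [])    = ↭-refl
swapAt-↭ (suc zero)    (x ∷ y ∷ r) = ↭-swap y x ↭-refl
swapAt-↭ (suc (suc j)) []          = ↭-refl
swapAt-↭ (suc (suc j)) (x ∷ r)     = ↭-prep x (swapAt-↭ (suc j) r)

below-swapAt : ∀ m j l → below m (swapAt j l) ≡ below m l
below-swapAt m zero          l           = refl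
below-swapAt m (suc zero)    []          = refl
below-swapAt m (suc zero)    (x ∷ [])    = refl
below-swapAt m (suc zero)    (x ∷ y ∷ r) with m <ᵇ x | m <ᵇ y
... | true  | true  = refl
... | true  | false = refl
... | false | true  = refl
... | false | false = refl
below-swapAt m (suc (suc j)) []          = refl
below-swapAt m (suc (suc j)) (x ∷ r) with m <ᵇ x
... | true  = below-swapAt m (suc j) r
... | false = cong suc (below-swapAt m (suc j) r)

below-∷< : ∀ {m x} r → m < x → below m (x ∷ r) ≡ below m r
below-∷< r m<x rewrite <⇒<ᵇ≡true m<x = refl

below-tail≤ : ∀ m x r → below m r ≤ below m (x ∷ r)
below-tail≤ m x r with m <ᵇ x
... | true  = ≤-refl
... | false = n≤1+n _

below-∷≤ : ∀ m x r → below m (x ∷ r) ≤ suc (below m r)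
below-∷≤ m x r with m <ᵇ x
... | true  = n≤1+n _
... | false = ≤-refl

+-exchange : ∀ a b c → a + (b + c) ≡ b + (a + c)
+-exchange = solve-∀

-- Only the two exchanged entries change their relative order, so at most one inversion is gained.
inv-swapAt≤ : ∀ j l → inv (swapAt j l) ≤ suc (inv l)
inv-swapAt≤ zero          l           = n≤1+n _
inv-swapAt≤ (suc zero)    []          = n≤1+n _
inv-swapAt≤ (suc zero)    (x ∷ [])    = n≤1+n _
inv-swapAt≤ (suc zero)    (x ∷ y ∷ r) = begin
  below y (x ∷ r) + (below x r + inv r)       ≤⟨ +-monoˡ-≤ _ (below-∷≤ y x r) ⟩
  suc (below y r + (below x r + inv r))       ≡⟨ cong suc (+-exchange (below y r) (below x r) (inv r)) ⟩
  suc (below x r + (below y r + inv r))       ≤⟨ s≤s (+-monoˡ-≤ _ (below-tail≤ x y r)) ⟩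
  suc (below x (y ∷ r) + (below y r + inv r)) ∎
  where open ≤-Reasoning
inv-swapAt≤ (suc (suc j)) []          = n≤1+n _
inv-swapAt≤ (suc (suc j)) (x ∷ r) rewrite below-swapAt x (suc j) r =
  ≤-trans (+-monoʳ-≤ (below x r) (inv-swapAt≤ (suc j) r)) (≤-reflexive (+-suc (below x r) (inv r)))

-- For a permutation w, crossing 0 k w is false exactly when w preserves {1, …, k}.
crossing : ℕ → ℕ → List ℕ → Bool
crossing m zero    l        = 0 <ᵇ below m l
crossing m (suc k) []       = false
crossing m (suc k) (y ∷ ys) = crossing (m ⊔ y) k ys

-- Both exchanged positions lie on the same side of the cut, so neither the maximum to its left nor
-- the collection of entries to its right changes.
crossing-swapAt-≢ : ∀ m j k l → suc j ≢ k → crossing m k (swapAt (suc j) l) ≡ crossing m k l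
crossing-swapAt-≢ m j zero l _ = cong (0 <ᵇ_) (below-swapAt m (suc j) l)
crossing-swapAt-≢ m zero (suc k)       []          _  = refl
crossing-swapAt-≢ m zero (suc k)       (x ∷ [])    _  = refl
crossing-swapAt-≢ m zero (suc zero)    (x ∷ y ∷ r) ne = ⊥-elim (ne refl)
crossing-swapAt-≢ m zero (suc (suc k)) (x ∷ y ∷ r) _  =
  cong (λ v → crossing v k r)
    (trans (⊔-assoc m y x) (trans (cong (m ⊔_) (⊔-comm y x)) (sym (⊔-assoc m x y))))
crossing-swapAt-≢ m (suc j) (suc k)    []          _  = refl
crossing-swapAt-≢ m (suc j) (suc k)    (x ∷ r)     ne = crossing-swapAt-≢ (m ⊔ x) j k r (ne ∘ cong suc)

-- A gain of an inversion means that the larger entry, or an equal one, now stands first; this pair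
-- straddles the cut.
crossing-swapAt-≡ : ∀ m j l → inv (swapAt (suc j) l) ≡ suc (inv l) →
  crossing m (suc j) (swapAt (suc j) l) ≡ true
crossing-swapAt-≡ m zero (x ∷ y ∷ r) eq with y <ᵇ x | compareᵇ y x
... | false | ge x≤y rewrite ≥⇒<ᵇ≡false (≤-trans x≤y (m≤n⊔m m y)) = refl
... | true  | lt y<x rewrite ≥⇒<ᵇ≡false (<⇒≤ y<x) | +-exchange (below y r) (below x r) (inv r) =
  ⊥-elim (<⇒≢ (m≤n⇒m≤1+n (n<1+n _)) eq)
crossing-swapAt-≡ m (suc j) (x ∷ r) eq rewrite below-swapAt x (suc j) r =
  crossing-swapAt-≡ (m ⊔ x) j r
    (+-cancelˡ-≡ (below x r) _ _ (trans eq (sym (+-suc (below x r) (inv r)))))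

act : List ℕ → List ℕ → List ℕ
act = foldl (λ v i → swapAt i v)

inv-act≤ : ∀ l ws → inv (act l ws) ≤ length ws + inv l
inv-act≤ l []       = ≤-refl
inv-act≤ l (j ∷ ws) = ≤-trans (inv-act≤ (swapAt j l) ws)
  (≤-trans (+-monoʳ-≤ (length ws) (inv-swapAt≤ j l)) (≤-reflexive (+-suc (length ws) (inv l))))

-- If each letter raises the inversion number, it creates a crossing at its position, and no
-- letter changes the crossings at other positions.
crossing-act : ∀ l ws → All (1 ≤_) ws → inv (act l ws) ≡ length ws + inv l → ∀ k →
  (crossing 0 k l ≡ true ⊎ k ∈ ws → crossing 0 k (act l ws) ≡ true)
  × (crossing 0 k (act l ws) ≡ true → crossing 0 k l ≡ true ⊎ k ∈ ws)
crossing-act l [] _ _ k = (λ { (inj₁ c) → c }) , inj₁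
crossing-act l (suc j ∷ ws) (_ ∷ 1≤ws) eq k = to , from
  where
  -- A letter gains at most one inversion, so a total gain of one per letter forces every letter to
  -- gain exactly one.
  ascent : inv (swapAt (suc j) l) ≡ suc (inv l)
  ascent = ≤-antisym (inv-swapAt≤ (suc j) l)
    (+-cancelˡ-≤ (length ws) _ _
      (≤-trans (≤-reflexive (trans (+-suc (length ws) (inv l)) (sym eq))) (inv-act≤ (swapAt (suc j) l) ws)))

  ih = crossing-act (swapAt (suc j) l) ws 1≤ws
    (trans eq (trans (sym (+-suc (length ws) (inv l))) (cong (length ws +_) (sym ascent)))) k

  to : crossing 0 k l ≡ true ⊎ k ∈ suc j ∷ ws → crossing 0 k (act l (suc j ∷ ws)) ≡ true
  to (inj₂ (here refl)) = proj₁ ih (inj₁ (crossing-swapAt-≡ 0 j l ascent))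
  to (inj₂ (there k∈))  = proj₁ ih (inj₂ k∈)
  to (inj₁ c) with suc j ≟ k
  ... | yes refl = proj₁ ih (inj₁ (crossing-swapAt-≡ 0 j l ascent))
  ... | no  j≢k  = proj₁ ih (inj₁ (trans (crossing-swapAt-≢ 0 j k l j≢k) c))

  from : crossing 0 k (act l (suc j ∷ ws)) ≡ true → crossing 0 k l ≡ true ⊎ k ∈ suc j ∷ ws
  from c with proj₂ ih c
  ... | inj₂ k∈ = inj₂ (there k∈)
  ... | inj₁ c′ with suc j ≟ k
  ...   | yes refl = inj₂ (here refl)
  ...   | no  j≢k  = inj₁ (trans (sym (crossing-swapAt-≢ 0 j k l j≢k)) c′)

-- Sorted lists and words from adjacent descents

below-All> : ∀ {m l} → All (m <_) l → below m l ≡ 0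
below-All> []            = refl
below-All> (m<x ∷ m<l) rewrite <⇒<ᵇ≡true m<x = below-All> m<l

inv-sorted : ∀ {l} → AllPairs _<_ l → inv l ≡ 0
inv-sorted []           = refl
inv-sorted (x<l ∷ l↗) = cong₂ _+_ (below-All> x<l) (inv-sorted l↗)

crossing-sorted : ∀ {m l} k → AllPairs _<_ (m ∷ l) → crossing m k l ≡ false
crossing-sorted zero (m<l ∷ _) rewrite below-All> m<l = refl
crossing-sorted {l = []}    (suc k) _ = refl
crossing-sorted {l = x ∷ l} (suc k) ((m<x ∷ _) ∷ l↗) rewrite m≤n⇒m⊔n≡n (<⇒≤ m<x) = crossing-sorted k l↗

-- The leading 0 matches the initial maximum in `crossing 0 k`.
idLine-sorted : ∀ n → AllPairs _<_ (0 ∷ idLine n)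
idLine-sorted n = All.map⁺ (All.universal (λ _ → s≤s z≤n) _)
  ∷ AllPairs.map⁺ (AllPairs.applyUpTo⁺₁ id n (λ i<j _ → s≤s i<j))

head+length≤ : ∀ {b} x xs → AllPairs _<_ (x ∷ xs) → All (_≤ b) (x ∷ xs) → x + length xs ≤ b
head+length≤ x []       _                    (x≤b ∷ _)  = ≤-trans (≤-reflexive (+-identityʳ x)) x≤b
head+length≤ x (y ∷ ys) ((x<y ∷ _) ∷ ys↗) (_ ∷ ys≤b) =
  ≤-trans (≤-reflexive (+-suc x (length ys))) 
  (≤-trans (+-monoˡ-≤ (length ys) x<y) (head+length≤ y ys ys↗ ys≤b))

-- A strictly increasing list confined to a window as long as itself must fill the window. The
-- function `f` is given up to pointwise equality so that the recursion can pass to `f ∘ suc`.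
sorted≡applyUpTo : ∀ m l f → (∀ i → f i ≡ suc (m + i)) → AllPairs _<_ (m ∷ l) →
  All (_≤ m + length l) l → l ≡ applyUpTo f (length l)
sorted≡applyUpTo m []       f f≡ _ _ = refl
sorted≡applyUpTo m (x ∷ xs) f f≡ ((m<x ∷ _) ∷ xs↗) bounds@(_ ∷ xs≤)
  with refl ← ≤-antisym m<x (+-cancelʳ-≤ (length xs) _ _
    (≤-trans (head+length≤ x xs xs↗ bounds) (≤-reflexive (+-suc m (length xs)))))
  = cong₂ _∷_ (sym (trans (f≡ 0) (cong suc (+-identityʳ m))))
      (sorted≡applyUpTo (suc m) xs (f ∘ suc) (λ i → trans (f≡ (suc i)) (cong suc (+-suc m i))) xs↗
        (All.map (λ v≤ → ≤-trans v≤ (≤-reflexive (+-suc m (length xs)))) xs≤))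

sorted≡idLine : ∀ n l → length l ≡ n → All (λ v → 1 ≤ v × v ≤ n) l → AllPairs _<_ l → l ≡ idLine n
sorted≡idLine n l refl bounds l↗ = trans
  (sorted≡applyUpTo 0 l suc (λ _ → refl) (All.map proj₁ bounds ∷ l↗) (All.map proj₂ bounds))
  (sym (map-upTo suc n))

-- A step of bubble sort. Distinctness makes the descent strict; swapping two equal entries would
-- not lower `inv`, as ties count as inversions.
descent : ∀ l → Unique l → AllPairs _<_ l ⊎
  (∃[ j ] (1 ≤ j × suc j ≤ length l) × inv l ≡ suc (inv (swapAt j l)) × swapAt j (swapAt j l) ≡ l)
descent []       _        = inj₁ []
descent (x ∷ xs) (x∉ ∷ u) with descent xs u
descent (x ∷ xs) (x∉ ∷ u) | inj₂ (suc j , (_ , j<) , inv≡ , invol) =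
  inj₂ (suc (suc j) , (s≤s z≤n , s≤s j<) ,
    trans (cong (below x xs +_) inv≡)
      (trans (+-suc (below x xs) _)
        (cong (λ b → suc (b + inv (swapAt (suc j) xs))) (sym (below-swapAt x (suc j) xs)))) ,
    cong (x ∷_) invol)
descent (x ∷ []) _ | inj₁ _ = inj₁ ([] ∷ [])
descent (x ∷ y ∷ ys) ((x≢y ∷ _) ∷ _) | inj₁ (y< ∷ ys↗) with x <ᵇ y | compareᵇ x y
... | true  | lt x<y = inj₁ ((x<y ∷ All.map (<-trans x<y) y<) ∷ y< ∷ ys↗)
... | false | ge y≤x =
  inj₂ (1 , (s≤s z≤n , s≤s (s≤s z≤n)) ,
    cong suc (trans (+-exchange (below x ys) (below y ys) (inv ys))
      (cong (_+ (below x ys + inv ys)) (sym (below-∷< ys (≤∧≢⇒< y≤x (x≢y ∘ sym)))))) ,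
    refl)

-- Sorting `l` by adjacent descents and reading the swaps backwards spells `l` with one letter per
-- inversion.
word : ∀ k n l → inv l ≡ k → length l ≡ n → All (λ v → 1 ≤ v × v ≤ n) l → Unique l →
  ∃[ ws ] ValidWord n ws × prod n ws ≡ l × length ws ≡ k
word k n l inv≡ len bounds u with descent l u
word zero n l inv≡ len bounds u | inj₁ l↗ = [] , [] , sym (sorted≡idLine n l len bounds l↗) , refl
word (suc k) n l inv≡ len bounds u | inj₁ l↗ with () ← trans (sym inv≡) (inv-sorted l↗)
word zero n l inv≡ len bounds u | inj₂ (_ , _ , inv≡′ , _) with () ← trans (sym inv≡) inv≡′
word (suc k) n l inv≡ len bounds u | inj₂ (j , (1≤j , j<) , inv≡′ , invol) =
  let l↭ = ↭-sym (swapAt-↭ j l)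
      ws , valid , prod≡ , len-ws = word k n (swapAt j l)
        (suc-injective (trans (sym inv≡′) inv≡))
        (trans (sym (↭-length l↭)) len)
        (All-resp-↭ l↭ bounds)
        (Permutation.Unique-resp-↭ (setoid ℕ) (↭⇒↭ₛ l↭) u)
  in ws ++ j ∷ []
   , All.++⁺ valid ((1≤j , subst (suc j ≤_) len j<) ∷ [])
   , trans (foldl-∷ʳ _ (idLine n) j ws) (trans (cong (swapAt j) prod≡) invol)
   , trans (length-++ ws) (trans (+-comm (length ws) 1) (cong suc len-ws))

-- Reduced words of a permutation

toList-All : ∀ {A : Set} {P : A → Set} {n} (xs : Vec A n) → (∀ i → P (lookup xs i)) → All P (toList xs)
toList-All []       _  = []
toList-All (x ∷ xs) ps = ps Fin.zero ∷ toList-All xs (ps ∘ Fin.suc)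

toList-Unique : ∀ {A : Set} {n} (xs : Vec A n) →
  (∀ i j → lookup xs i ≡ lookup xs j → i ≡ j) → Unique (toList xs)
toList-Unique []       _      = []
toList-Unique (x ∷ xs) inj =
  toList-All xs (λ i eq → Fin.0≢1+n (inj Fin.zero (Fin.suc i) eq))
  ∷ toList-Unique xs (λ i j eq → Fin.suc-injective (inj (Fin.suc i) (Fin.suc j) eq))

module _ {n} (w : Vec (Fin n) n) (w-perm : IsPerm w) {r} (r-reduced : IsReduced w r) where

  private
    valid = proj₁ (proj₁ r-reduced)
    prod≡ = proj₂ (proj₁ r-reduced)

    inv-idLine : inv (idLine n) ≡ 0
    inv-idLine = inv-sorted (AllPairs.tail (idLine-sorted n))

  inv≤length : inv (prod n r) ≤ length r
  inv≤length = ≤-trans (inv-act≤ (idLine n) r)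
    (≤-reflexive (trans (cong (length r +_) inv-idLine) (+-identityʳ (length r))))

  -- Minimality of `r` against the result of `word` bounds the length above; a gain of at most one
  -- inversion per letter bounds it below.
  length≡inv : length r ≡ inv (oneLine w)
  length≡inv = ≤-antisym
    (let ws , valid-ws , prod-ws , len-ws = word _ n (oneLine w) refl
           (trans (length-map _ (toList w)) (length-toList w))
           (All.map⁺ (toList-All w (λ i → s≤s z≤n , Fin.toℕ<n (lookup w i))))
           (Unique.map⁺ (Fin.toℕ-injective ∘ suc-injective) (toList-Unique w w-perm))
     in ≤-trans (proj₂ r-reduced ws (valid-ws , prod-ws)) (≤-reflexive len-ws))
    (subst (λ l → inv l ≤ length r) prod≡ inv≤length)

  -- By `length≡inv` every letter of `r` gains an inversion, so `crossing-act` applies from the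
  -- identity, which has no crossings.
  letter⇔crossing : ∀ k →
    (k ∈ r → crossing 0 k (oneLine w) ≡ true) × (crossing 0 k (oneLine w) ≡ true → k ∈ r)
  letter⇔crossing k with crossing-act (idLine n) r (All.map proj₁ valid)
    (trans (cong inv prod≡) (trans (sym length≡inv)
      (sym (trans (cong (length r +_) inv-idLine) (+-identityʳ (length r)))))) k
  ... | to , from rewrite prod≡ = to ∘ inj₂ , λ c → letter (from c)
    where
    letter : crossing 0 k (idLine n) ≡ true ⊎ k ∈ r → k ∈ r
    letter (inj₂ k∈) = k∈
    letter (inj₁ c) with () ← trans (sym c) (crossing-sorted k (idLine-sorted n))

-- Support size as a number of distinct letters

-- Cut 0 lies before the first entry of `l`. For a tail `l` with `m` the head of the whole list, cut
-- `k` belongs to the letter `suc k`.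
crossingPositions : ℕ → List ℕ → List ℕ
crossingPositions m l = filter (λ k → crossing m k l Bool.≟ true) (upTo (length l))

length-filter-applyUpTo-suc : ∀ (P : ℕ → Bool) n f →
  length (filter (λ k → P k Bool.≟ true) (applyUpTo (suc ∘ f) n))
    ≡ length (filter (λ k → P (suc k) Bool.≟ true) (applyUpTo f n))
length-filter-applyUpTo-suc P zero    f = refl
length-filter-applyUpTo-suc P (suc n) f with P (suc (f 0))
... | true  = cong suc (length-filter-applyUpTo-suc P n (f ∘ suc))
... | false = length-filter-applyUpTo-suc P n (f ∘ suc)

length-crossingPositions : ∀ m l → length (crossingPositions m l) ≡ crossings m l
length-crossingPositions m [] = refl
length-crossingPositions m (y ∷ ys)
  with ih ← trans (length-filter-applyUpTo-suc (λ k → crossing m k (y ∷ ys)) (length ys) id)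
                  (length-crossingPositions (m ⊔ y) ys)
  with 0 <ᵇ below m (y ∷ ys)
... | true  = cong suc ih
... | false = ih

crossing⇒<length : ∀ m k l → crossing m k l ≡ true → k < length l
crossing⇒<length m zero    (_ ∷ l) _ = s≤s z≤n
crossing⇒<length m (suc k) (y ∷ l) c = s≤s (crossing⇒<length (m ⊔ y) k l c)

-- Two duplicate-free lists with the same members are permutations of each other, hence equally
-- long.
length-deduplicate≡supportSize : ∀ r l → All (1 ≤_) r →
  (∀ k → (k ∈ r → crossing 0 k l ≡ true) × (crossing 0 k l ≡ true → k ∈ r)) →
  length (deduplicate _≟_ r) ≡ supportSize l
length-deduplicate≡supportSize []      [] _ _ = refl
length-deduplicate≡supportSize (zero ∷ r)  [] (() ∷ _) _
length-deduplicate≡supportSize (suc k ∷ r) [] _ letters with () ← proj₁ (letters (suc k)) (here refl)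
length-deduplicate≡supportSize r (x ∷ xs) 1≤r letters = trans
  (↭-length (∼bag⇒↭ (unique∧set⇒bag (deduplicate-! r)
    (Unique.map⁺ suc-injective (Unique.filter⁺ _ (Unique.upTo⁺ (length xs)))) (mk⇔ to from))))
  (trans (length-map suc (crossingPositions x xs)) (length-crossingPositions x xs))
  where
  to : ∀ {k} → k ∈ deduplicate _≟_ r → k ∈ map suc (crossingPositions x xs)
  to {k} k∈ with k | ∈-deduplicate⁻ _≟_ r k∈
  ... | zero  | k∈r with () ← All.lookup 1≤r k∈r
  ... | suc i | k∈r = let c = proj₁ (letters (suc i)) k∈r in
    ∈-map⁺ suc (∈-filter⁺ _ (∈-upTo⁺ (crossing⇒<length x i xs c)) c)

  from : ∀ {k} → k ∈ map suc (crossingPositions x xs) → k ∈ deduplicate _≟_ r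
  from k∈ with i , i∈ , refl ← ∈-map⁻ suc k∈ =
    ∈-deduplicate⁺ _≟_ (proj₂ (letters (suc i)) (proj₂ (∈-filter⁻ _ {xs = upTo (length xs)} i∈)))

-- Occurrences of the patterns in Φ

Agree : Bool → ℕ → ℕ → Set
Agree true  x y = x < y
Agree false x y = y ≤ x

agree⁻ : ∀ β x y → T (eqB β (x <ᵇ y)) → Agree β x y
agree⁻ true  x y t with x <ᵇ y | compareᵇ x y
... | true  | lt x<y = x<y
agree⁻ false x y t with x <ᵇ y | compareᵇ x y
... | false | ge y≤x = y≤x

agree⁺ : ∀ β x y → Agree β x y → T (eqB β (x <ᵇ y))
agree⁺ true  x y x<y rewrite <⇒<ᵇ≡true x<y = tt
agree⁺ false x y y≤x rewrite ≥⇒<ᵇ≡false y≤x = tt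

-- Against a literal pattern, `HeadSimilar` and `Similar` compute to nested tuples of strict and
-- weak inequalities. Mismatched lengths default to `⊤`; the conversions from and to `sameOrder` fix
-- the lengths.
HeadSimilar : ℕ → List ℕ → ℕ → List ℕ → Set
HeadSimilar p (q ∷ qs) x (y ∷ ys) = Agree (p <ᵇ q) x y × HeadSimilar p qs x ys
HeadSimilar p _        x _        = ⊤

Similar : List ℕ → List ℕ → Set
Similar (p ∷ ps) (x ∷ xs) = HeadSimilar p ps x xs × Similar ps xs
Similar _        _        = ⊤

∧⁻ : ∀ {a b} → T (a ∧ b) → T a × T b
∧⁻ {true} t = tt , t

∧⁺ : ∀ {a b} → T a → T b → T (a ∧ b)
∧⁺ {true} _ t = t

sameOrder⇒length : ∀ ps xs → T (sameOrder ps xs) → length ps ≡ length xs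
sameOrder⇒length []       []       _ = refl
sameOrder⇒length (p ∷ ps) (x ∷ xs) t = cong suc (sameOrder⇒length ps xs (proj₂ (∧⁻ t)))

similar₄⁺ : ∀ p q r s {a b c d} → Similar (p ∷ q ∷ r ∷ s ∷ []) (a ∷ b ∷ c ∷ d ∷ []) →
  T (sameOrder (p ∷ q ∷ r ∷ s ∷ []) (a ∷ b ∷ c ∷ d ∷ []))
similar₄⁺ p q r s ((pq , pr , ps , _) , (qr , qs , _) , (rs , _) , _) =
  ∧⁺ (∧⁺ (agree⁺ (p <ᵇ q) _ _ pq) (∧⁺ (agree⁺ (p <ᵇ r) _ _ pr) (∧⁺ (agree⁺ (p <ᵇ s) _ _ ps) tt)))
  (∧⁺ (∧⁺ (agree⁺ (q <ᵇ r) _ _ qr) (∧⁺ (agree⁺ (q <ᵇ s) _ _ qs) tt))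
  (∧⁺ (∧⁺ (agree⁺ (r <ᵇ s) _ _ rs) tt) tt))

similar₅⁺ : ∀ p q r s t {a b c d e} → Similar (p ∷ q ∷ r ∷ s ∷ t ∷ []) (a ∷ b ∷ c ∷ d ∷ e ∷ []) →
  T (sameOrder (p ∷ q ∷ r ∷ s ∷ t ∷ []) (a ∷ b ∷ c ∷ d ∷ e ∷ []))
similar₅⁺ p q r s t ((pq , pr , ps , pt , _) , rest) =
  ∧⁺ (∧⁺ (agree⁺ (p <ᵇ q) _ _ pq) (∧⁺ (agree⁺ (p <ᵇ r) _ _ pr)
       (∧⁺ (agree⁺ (p <ᵇ s) _ _ ps) (∧⁺ (agree⁺ (p <ᵇ t) _ _ pt) tt))))
  (similar₄⁺ q r s t rest)

similar₄⁻ : ∀ p q r s {a b c d} → T (sameOrder (p ∷ q ∷ r ∷ s ∷ []) (a ∷ b ∷ c ∷ d ∷ [])) →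
  Similar (p ∷ q ∷ r ∷ s ∷ []) (a ∷ b ∷ c ∷ d ∷ [])
similar₄⁻ p q r s t₀ =
  let h₁ , t₁ = ∧⁻ t₀
      h₂ , t₂ = ∧⁻ t₁
      h₃ , _  = ∧⁻ t₂
      pq , h₁ = ∧⁻ h₁
      pr , h₁ = ∧⁻ h₁
      ps , _  = ∧⁻ h₁
      qr , h₂ = ∧⁻ h₂
      qs , _  = ∧⁻ h₂
      rs , _  = ∧⁻ h₃
  in (agree⁻ (p <ᵇ q) _ _ pq , agree⁻ (p <ᵇ r) _ _ pr , agree⁻ (p <ᵇ s) _ _ ps , tt)
   , (agree⁻ (q <ᵇ r) _ _ qr , agree⁻ (q <ᵇ s) _ _ qs , tt)
   , (agree⁻ (r <ᵇ s) _ _ rs , tt) , tt , tt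

similar₅⁻ : ∀ p q r s t {a b c d e} → T (sameOrder (p ∷ q ∷ r ∷ s ∷ t ∷ []) (a ∷ b ∷ c ∷ d ∷ e ∷ [])) →
  Similar (p ∷ q ∷ r ∷ s ∷ t ∷ []) (a ∷ b ∷ c ∷ d ∷ e ∷ [])
similar₅⁻ p q r s t t₀ =
  let h₁ , t₁ = ∧⁻ t₀
      pq , h₁ = ∧⁻ h₁
      pr , h₁ = ∧⁻ h₁
      ps , h₁ = ∧⁻ h₁
      pt , _  = ∧⁻ h₁
  in (agree⁻ (p <ᵇ q) _ _ pq , agree⁻ (p <ᵇ r) _ _ pr
    , agree⁻ (p <ᵇ s) _ _ ps , agree⁻ (p <ᵇ t) _ _ pt , tt)
   , similar₄⁻ q r s t t₁

data FourSimilar (ps : List ℕ) : List ℕ → Set where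
  four : ∀ {a b c d} → Similar ps (a ∷ b ∷ c ∷ d ∷ []) → FourSimilar ps (a ∷ b ∷ c ∷ d ∷ [])

data FiveSimilar (ps : List ℕ) : List ℕ → Set where
  five : ∀ {a b c d e} → Similar ps (a ∷ b ∷ c ∷ d ∷ e ∷ []) → FiveSimilar ps (a ∷ b ∷ c ∷ d ∷ e ∷ [])

fourSimilar : ∀ p q r s xs → T (sameOrder (p ∷ q ∷ r ∷ s ∷ []) xs) → FourSimilar (p ∷ q ∷ r ∷ s ∷ []) xs
fourSimilar p q r s xs t with xs | sameOrder⇒length (p ∷ q ∷ r ∷ s ∷ []) xs t | t
... | _ ∷ _ ∷ _ ∷ _ ∷ [] | _ | t′ = four (similar₄⁻ p q r s t′)

fiveSimilar : ∀ p q r s t xs → T (sameOrder (p ∷ q ∷ r ∷ s ∷ t ∷ []) xs) →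
  FiveSimilar (p ∷ q ∷ r ∷ s ∷ t ∷ []) xs
fiveSimilar p q r s t xs τ with xs | sameOrder⇒length (p ∷ q ∷ r ∷ s ∷ t ∷ []) xs τ | τ
... | _ ∷ _ ∷ _ ∷ _ ∷ _ ∷ [] | _ | τ′ = five (similar₅⁻ p q r s t τ′)

pattern as4321 t = here t
pattern as34512 t = there (here t)
pattern as45123 t = there (there (here t))
pattern as35412 t = there (there (there (here t)))
pattern as43512 t = there (there (there (there (here t))))
pattern as45132 t = there (there (there (there (there (here t)))))
pattern as45213 t = there (there (there (there (there (there (here t))))))
pattern as53412 t = there (there (there (there (there (there (there (here t)))))))
pattern as45312 t = there (there (there (there (there (there (there (there (here t))))))))
pattern as45231 t = there (there (there (there (there (there (there (there (there (here t)))))))))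

HasΦ : List ℕ → Set
HasΦ s = Any (λ p → T (sameOrder p s)) Φ

-- Witnesses for two entries below `x` in one block: they form an inversion, or an earlier entry
-- above `x` ties them together.
data BadBelow (x : ℕ) : List ℕ → Set where
  falling : ∀ {a b} → a ≤ x → b ≤ a → BadBelow x (a ∷ b ∷ [])
  capped  : ∀ {u a b} → x < u → a ≤ x → b ≤ x → BadBelow x (u ∷ a ∷ b ∷ [])

-- One constructor per summand of `excessAt`: `excessBelow`, `count412` and `choose₂`, in this
-- order.
data BadAt (x : ℕ) : List ℕ → Set where
  descending : ∀ {y s} → y ≤ x → BadBelow y s → BadAt x (y ∷ s)
  twoCaps    : ∀ {u v a b} → x < u → x < v → b ≤ x → a < b → BadAt x (u ∷ v ∷ a ∷ b ∷ [])
  threeBelow : ∀ {u a b c} → x < u → a ≤ x → b ≤ x → c ≤ x → BadAt x (u ∷ a ∷ b ∷ c ∷ [])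

data Bad : List ℕ → Set where
  bad : ∀ {x s} → BadAt x s → Bad (x ∷ s)

Φ⇒Bad : ∀ {s} → HasΦ s → Bad s
Φ⇒Bad {xs} (as4321 t) with fourSimilar 4 3 2 1 xs t
... | four ((b≤a , _) , (c≤b , _) , (d≤c , _) , _) = bad (descending b≤a (falling c≤b d≤c))
Φ⇒Bad {xs} (as34512 t) with fiveSimilar 3 4 5 1 2 xs t
... | five ((a<b , a<c , _ , e≤a , _) , _ , _ , (d<e , _) , _) = bad (twoCaps a<b a<c e≤a d<e)
Φ⇒Bad {xs} (as45123 t) with fiveSimilar 4 5 1 2 3 xs t
... | five ((a<b , c≤a , d≤a , e≤a , _) , _) = bad (threeBelow a<b c≤a d≤a e≤a)
Φ⇒Bad {xs} (as35412 t) with fiveSimilar 3 5 4 1 2 xs t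
... | five ((a<b , a<c , _ , e≤a , _) , _ , _ , (d<e , _) , _) = bad (twoCaps a<b a<c e≤a d<e)
Φ⇒Bad {xs} (as43512 t) with fiveSimilar 4 3 5 1 2 xs t
... | five ((b≤a , _) , (b<c , d≤b , e≤b , _) , _) = bad (descending b≤a (capped b<c d≤b e≤b))
Φ⇒Bad {xs} (as45132 t) with fiveSimilar 4 5 1 3 2 xs t
... | five ((a<b , c≤a , d≤a , e≤a , _) , _) = bad (threeBelow a<b c≤a d≤a e≤a)
Φ⇒Bad {xs} (as45213 t) with fiveSimilar 4 5 2 1 3 xs t
... | five ((a<b , c≤a , d≤a , e≤a , _) , _) = bad (threeBelow a<b c≤a d≤a e≤a)
Φ⇒Bad {xs} (as53412 t) with fiveSimilar 5 3 4 1 2 xs t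
... | five ((b≤a , _) , (b<c , d≤b , e≤b , _) , _) = bad (descending b≤a (capped b<c d≤b e≤b))
Φ⇒Bad {xs} (as45312 t) with fiveSimilar 4 5 3 1 2 xs t
... | five ((a<b , c≤a , d≤a , e≤a , _) , _) = bad (threeBelow a<b c≤a d≤a e≤a)
Φ⇒Bad {xs} (as45231 t) with fiveSimilar 4 5 2 3 1 xs t
... | five ((a<b , c≤a , d≤a , e≤a , _) , _) = bad (threeBelow a<b c≤a d≤a e≤a)

4321∈Φ : ∀ {a b c d} → b ≤ a → c ≤ b → d ≤ c → HasΦ (a ∷ b ∷ c ∷ d ∷ [])
4321∈Φ b≤a c≤b d≤c = as4321 (similar₄⁺ 4 3 2 1
  ((b≤a , ≤-trans c≤b b≤a , ≤-trans d≤c (≤-trans c≤b b≤a) , tt)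
  , (c≤b , ≤-trans d≤c c≤b , tt) , (d≤c , tt) , tt , tt))

-- Deciding the comparisons that `Bad` leaves open completes the configuration to a pattern of
-- length five, unless a 4321 appears inside it.
Bad⇒Φ : ∀ {s} → Bad s → ∃[ t ] t ⊆ s × HasΦ t
Bad⇒Φ (bad (descending y≤x (falling a≤y b≤a))) = _ , ⊆-refl , 4321∈Φ y≤x a≤y b≤a
Bad⇒Φ (bad {x} (descending y≤x (capped {u} {a} {b} y<u a≤y b≤y))) with <-≤-connex a b
-- Without the cap `u`, the remaining four entries descend.
... | inj₂ b≤a = _ , refl ∷ refl ∷ u ∷ʳ ⊆-refl , 4321∈Φ y≤x a≤y b≤a
... | inj₁ a<b with <-≤-connex x u
...   | inj₁ x<u = _ , ⊆-refl , as43512 (similar₅⁺ 4 3 5 1 2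
        ( (y≤x , x<u , ≤-trans a≤y y≤x , ≤-trans b≤y y≤x , tt)
        , (y<u , a≤y , b≤y , tt)
        , (<⇒≤ (≤-<-trans a≤y y<u) , <⇒≤ (≤-<-trans b≤y y<u) , tt)
        , (a<b , tt) , tt , tt))
...   | inj₂ u≤x = _ , ⊆-refl , as53412 (similar₅⁺ 5 3 4 1 2
        ( (y≤x , u≤x , ≤-trans a≤y y≤x , ≤-trans b≤y y≤x , tt)
        , (y<u , a≤y , b≤y , tt)
        , (<⇒≤ (≤-<-trans a≤y y<u) , <⇒≤ (≤-<-trans b≤y y<u) , tt)
        , (a<b , tt) , tt , tt))
Bad⇒Φ (bad {x} (twoCaps {u} {v} {a} {b} x<u x<v b≤x a<b)) with <-≤-connex u v
... | inj₁ u<v = _ , ⊆-refl , as34512 (similar₅⁺ 3 4 5 1 2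
        ( (x<u , x<v , a≤x , b≤x , tt) , (u<v , ≤-trans a≤x (<⇒≤ x<u) , ≤-trans b≤x (<⇒≤ x<u) , tt)
        , (≤-trans a≤x (<⇒≤ x<v) , ≤-trans b≤x (<⇒≤ x<v) , tt) , (a<b , tt) , tt , tt))
  where a≤x = ≤-trans (<⇒≤ a<b) b≤x
... | inj₂ v≤u = _ , ⊆-refl , as35412 (similar₅⁺ 3 5 4 1 2
        ( (x<u , x<v , a≤x , b≤x , tt) , (v≤u , ≤-trans a≤x (<⇒≤ x<u) , ≤-trans b≤x (<⇒≤ x<u) , tt)
        , (≤-trans a≤x (<⇒≤ x<v) , ≤-trans b≤x (<⇒≤ x<v) , tt) , (a<b , tt) , tt , tt))
  where a≤x = ≤-trans (<⇒≤ a<b) b≤x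
Bad⇒Φ (bad {x} (threeBelow {u} {a} {b} {c} x<u a≤x b≤x c≤x)) =
  go (<-≤-connex a b) (<-≤-connex b c) (<-≤-connex a c)
  where
  below-x = x<u , a≤x , b≤x , c≤x , tt
  below-u = ≤-trans a≤x (<⇒≤ x<u) , ≤-trans b≤x (<⇒≤ x<u) , ≤-trans c≤x (<⇒≤ x<u) , tt

  go : a < b ⊎ b ≤ a → b < c ⊎ c ≤ b → a < c ⊎ c ≤ a → ∃[ t ] t ⊆ x ∷ u ∷ a ∷ b ∷ c ∷ [] × HasΦ t
  -- The cap `u` serves as the 4, and `x` is dropped.
  go (inj₂ b≤a) (inj₂ c≤b) _ = _ , x ∷ʳ ⊆-refl , 4321∈Φ (≤-trans a≤x (<⇒≤ x<u)) b≤a c≤b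
  go (inj₁ a<b) (inj₁ b<c) _ = _ , ⊆-refl , as45123 (similar₅⁺ 4 5 1 2 3
    (below-x , below-u , (a<b , <-trans a<b b<c , tt) , (b<c , tt) , tt , tt))
  go (inj₁ a<b) (inj₂ c≤b) (inj₁ a<c) = _ , ⊆-refl , as45132 (similar₅⁺ 4 5 1 3 2
    (below-x , below-u , (a<b , a<c , tt) , (c≤b , tt) , tt , tt))
  go (inj₁ a<b) (inj₂ c≤b) (inj₂ c≤a) = _ , ⊆-refl ,
    as45231 (similar₅⁺ 4 5 2 3 1
    (below-x , below-u , (a<b , c≤a , tt) , (c≤b , tt) , tt , tt))
  go (inj₂ b≤a) (inj₁ b<c) (inj₁ a<c) = _ , ⊆-refl ,
    as45213 (similar₅⁺ 4 5 2 1 3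
    (below-x , below-u , (b≤a , a<c , tt) , (b<c , tt) , tt , tt))
  go (inj₂ b≤a) (inj₁ b<c) (inj₂ c≤a) = _ , ⊆-refl ,
    as45312 (similar₅⁺ 4 5 3 1 2
    (below-x , below-u , (b≤a , c≤a , tt) , (b<c , tt) , tt , tt))

-- Positivity of the excess

below-⊆ : ∀ {x s xs} → s ⊆ xs → below x s ≤ below x xs
below-⊆ [] = z≤n
below-⊆ {x} {xs = z ∷ ys} (.z ∷ʳ sub) = ≤-trans (below-⊆ sub) (below-tail≤ x z ys)
below-⊆ {x} {z ∷ _} (refl ∷ sub) with x <ᵇ z
... | true  = below-⊆ sub
... | false = s≤s (below-⊆ sub)

below-All≤ : ∀ {x s} → All (_≤ x) s → below x s ≡ length s
below-All≤ []            = refl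
below-All≤ (a≤x ∷ s≤x) rewrite ≥⇒<ᵇ≡false a≤x = cong suc (below-All≤ s≤x)

length≤below : ∀ {x s xs} → All (_≤ x) s → s ⊆ xs → length s ≤ below x xs
length≤below s≤x sub = subst (_≤ _) (below-All≤ s≤x) (below-⊆ sub)

below⇒⊆ : ∀ k x xs → k ≤ below x xs → ∃[ s ] s ⊆ xs × All (_≤ x) s × length s ≡ k
below⇒⊆ zero x xs _ = [] , minimum xs , [] , refl
below⇒⊆ (suc k) x (y ∷ ys) k< with x <ᵇ y | compareᵇ x y
below⇒⊆ (suc k) x (y ∷ ys) k<       | true  | _ =
  let s , sub , s≤x , len = below⇒⊆ (suc k) x ys k< in s , y ∷ʳ sub , s≤x , len
below⇒⊆ (suc k) x (y ∷ ys) (s≤s k≤) | false | ge y≤x =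
  let s , sub , s≤x , len = below⇒⊆ k x ys k≤ in y ∷ s , refl ∷ sub , y≤x ∷ s≤x , cong suc len

-- Prepending `a` adds the crossing directly after `a`, and a larger running maximum preserves those
-- further right.
supportSize<crossings : ∀ a zs → 0 < below a zs → supportSize zs < crossings a zs
supportSize<crossings a (z ∷ zs) 0<b with below a (z ∷ zs)
... | suc _ = s≤s (crossings-mono (m≤n⊔m a z) zs)

supportSize<crossings⁻ : ∀ a zs → supportSize zs < crossings a zs → 0 < below a zs
supportSize<crossings⁻ a (z ∷ zs) s<c with a <ᵇ z | compareᵇ a z
... | false | _ = s≤s z≤n
... | true  | lt a<z with below a zs
...   | suc _ = s≤s z≤n
...   | zero rewrite m≤n⇒m⊔n≡n (<⇒≤ a<z) = ⊥-elim (<-irrefl refl s<c)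

skip : ∀ {a z : ℕ} {s zs} → a ≢ z → a ∷ s ⊆ z ∷ zs → a ∷ s ⊆ zs
skip a≢z (_ ∷ʳ sub)  = sub
skip a≢z (refl ∷ _) = ⊥-elim (a≢z refl)

tail-⊆ : ∀ {a z : ℕ} {s zs} → a ∷ s ⊆ z ∷ zs → s ⊆ zs
tail-⊆ (_ ∷ʳ sub) = ⊆-trans (_ ∷ʳ ⊆-refl) sub
tail-⊆ (_ ∷ sub)  = sub

pred-pos : ∀ {d} → 2 ≤ d → 0 < d ∸ 1
pred-pos (s≤s p) = p

pred-pos⁻ : ∀ {d} → 0 < d ∸ 1 → 2 ≤ d
pred-pos⁻ {suc d} p = s≤s p

-- At the first entry above `x`, two later entries below `x` suffice. A falling pair that starts
-- earlier is detected by the crossing which its first entry adds.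
excessBelow>0 : ∀ {x s} xs → BadBelow x s → s ⊆ xs → 0 < excessBelow x xs
excessBelow>0 [] (falling _ _) ()
excessBelow>0 [] (capped _ _ _) ()
excessBelow>0 {x} (z ∷ zs) b sub with x <ᵇ z | compareᵇ x z
excessBelow>0 (z ∷ zs) (falling a≤x b≤a) sub | true | lt x<z =
  pred-pos (length≤below (a≤x ∷ ≤-trans b≤a a≤x ∷ []) (skip (λ { refl → <⇒≱ x<z a≤x }) sub))
excessBelow>0 (z ∷ zs) (capped _ a≤x b≤x) sub | true | _ =
  pred-pos (length≤below (a≤x ∷ b≤x ∷ []) (tail-⊆ sub))
excessBelow>0 (z ∷ zs) b@(capped x<u _ _) sub | false | ge z≤x =
  ≤-trans (excessBelow>0 zs b (skip (λ { refl → <⇒≱ x<u z≤x }) sub)) (m≤m+n _ _)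
excessBelow>0 (z ∷ zs) b@(falling _ _) (.z ∷ʳ sub) | false | _ =
  ≤-trans (excessBelow>0 zs b sub) (m≤m+n _ _)
excessBelow>0 (z ∷ zs) (falling _ b≤z) (refl ∷ sub) | false | _ =
  ≤-trans (m<n⇒0<n∸m (supportSize<crossings z zs (length≤below (b≤z ∷ []) sub))) (m≤n+m _ _)

excessBelow>0⁻ : ∀ x xs → 0 < excessBelow x xs → ∃[ s ] s ⊆ xs × BadBelow x s
excessBelow>0⁻ x (z ∷ zs) e>0 with x <ᵇ z | compareᵇ x z
... | true | lt x<z with below⇒⊆ 2 x zs (pred-pos⁻ e>0)
...   | a ∷ b ∷ [] , sub , a≤x ∷ b≤x ∷ [] , _ = z ∷ a ∷ b ∷ [] , refl ∷ sub , capped x<z a≤x b≤x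
excessBelow>0⁻ x (z ∷ zs) e>0 | false | ge z≤x with 0<m+n (excessBelow x zs) e>0
...   | inj₁ e>0′ = let s , sub , b = excessBelow>0⁻ x zs e>0′ in s , z ∷ʳ sub , b
...   | inj₂ c>0 with below⇒⊆ 1 z zs (supportSize<crossings⁻ z zs (m∸n≢0⇒n<m (>⇒≢ c>0)))
...     | b ∷ [] , sub , b≤z ∷ [] , _ = z ∷ b ∷ [] , refl ∷ sub , falling z≤x b≤z

choose₂>0 : ∀ {d} → 2 ≤ d → 0 < choose₂ d
choose₂>0 (s≤s (s≤s _)) = s≤s z≤n

choose₂>0⁻ : ∀ {d} → 0 < choose₂ d → 2 ≤ d
choose₂>0⁻ {suc (suc d)} _ = s≤s (s≤s z≤n)

choose₂-pred>0 : ∀ {d} → 3 ≤ d → 0 < choose₂ (d ∸ 1)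
choose₂-pred>0 (s≤s p) = choose₂>0 p

choose₂-pred>0⁻ : ∀ {d} → 0 < choose₂ (d ∸ 1) → 3 ≤ d
choose₂-pred>0⁻ {suc d} p = s≤s (choose₂>0⁻ p)

BadBelow-lower : ∀ {x s} → BadBelow x s → ∃[ t ] t ⊆ s × All (_≤ x) t × length t ≡ 2
BadBelow-lower (falling a≤x b≤a)    = _ , ⊆-refl , a≤x ∷ ≤-trans b≤a a≤x ∷ [] , refl
BadBelow-lower (capped _ a≤x b≤x) = _ , _ ∷ʳ ⊆-refl , a≤x ∷ b≤x ∷ [] , refl

excessAt>0 : ∀ {x s} xs → BadAt x s → s ⊆ xs → 0 < excessAt x xs
excessAt>0 [] (descending _ _) ()
excessAt>0 [] (twoCaps _ _ _ _) ()
excessAt>0 [] (threeBelow _ _ _ _) ()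
excessAt>0 {x} (z ∷ zs) b sub with x <ᵇ z | compareᵇ x z
-- With `z` above `x` in front, `y` and the two entries from `BadBelow-lower` are three entries
-- below `x`, as in `threeBelow`.
excessAt>0 (z ∷ zs) (descending {y} y≤x b) sub | true | lt x<z
  with t , t⊆ , t≤y , len ← BadBelow-lower b =
  ≤-trans (choose₂-pred>0 (subst (λ k → suc k ≤ _) len
    (length≤below (y≤x ∷ All.map (λ v≤y → ≤-trans v≤y y≤x) t≤y)
      (skip (λ { refl → <⇒≱ x<z y≤x }) (⊆-trans (refl ∷ t⊆) sub)))))
  (m≤n+m _ _)
-- `z` takes the place of the first cap, and `x v a b` is a 3412 counted after it.
excessAt>0 {x} (z ∷ zs) (twoCaps {u} {v} {a} {b} _ x<v b≤x a<b) sub | true | _ =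
  ≤-trans (count>0 (λ s → sameOrder (3 ∷ 4 ∷ 1 ∷ 2 ∷ []) (x ∷ s)) (tail-⊆ sub)
    (similar₄⁺ 3 4 1 2 ((x<v , a≤x , b≤x , tt) ,
      (≤-trans a≤x (<⇒≤ x<v) , ≤-trans b≤x (<⇒≤ x<v) , tt) , (a<b , tt) , tt , tt)))
  (m≤m+n _ _)
  where a≤x = ≤-trans (<⇒≤ a<b) b≤x
excessAt>0 (z ∷ zs) (threeBelow _ a≤x b≤x c≤x) sub | true | _ =
  ≤-trans (choose₂-pred>0 (length≤below (a≤x ∷ b≤x ∷ c≤x ∷ []) (tail-⊆ sub))) (m≤n+m _ _)
excessAt>0 (z ∷ zs) b@(twoCaps x<u _ _ _) sub | false | ge z≤x =
  ≤-trans (excessAt>0 zs b (skip (λ { refl → <⇒≱ x<u z≤x }) sub)) (m≤m+n _ _)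
excessAt>0 (z ∷ zs) b@(threeBelow x<u _ _ _) sub | false | ge z≤x =
  ≤-trans (excessAt>0 zs b (skip (λ { refl → <⇒≱ x<u z≤x }) sub)) (m≤m+n _ _)
excessAt>0 (z ∷ zs) b@(descending _ _) (.z ∷ʳ sub) | false | _ =
  ≤-trans (excessAt>0 zs b sub) (m≤m+n _ _)
excessAt>0 (z ∷ zs) (descending _ b) (refl ∷ sub) | false | _ =
  ≤-trans (excessBelow>0 zs b sub) (m≤n+m _ _)

excessAt>0⁻ : ∀ x xs → 0 < excessAt x xs → ∃[ s ] s ⊆ xs × BadAt x s
excessAt>0⁻ x (z ∷ zs) e>0 with x <ᵇ z | compareᵇ x z
excessAt>0⁻ x (z ∷ zs) e>0 | false | ge z≤x with 0<m+n (excessAt x zs) e>0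
... | inj₁ e>0′ = let s , sub , b = excessAt>0⁻ x zs e>0′ in s , z ∷ʳ sub , b
... | inj₂ h>0  = let s , sub , b = excessBelow>0⁻ z zs h>0 in z ∷ s , refl ∷ sub , descending z≤x b
excessAt>0⁻ x (z ∷ zs) e>0 | true | lt x<z with 0<m+n (count412 x zs) e>0
... | inj₁ c>0 with count>0⁻ (λ s → sameOrder (3 ∷ 4 ∷ 1 ∷ 2 ∷ []) (x ∷ s)) zs c>0
...   | s , sub , t with fourSimilar 3 4 1 2 (x ∷ s) t
...     | four ((x<v , _ , b≤x , _) , _ , (a<b , _) , _) = z ∷ s , refl ∷ sub , twoCaps x<z x<v b≤x a<b
excessAt>0⁻ x (z ∷ zs) e>0 | true | lt x<z | inj₂ d>0 with below⇒⊆ 3 x zs (choose₂-pred>0⁻ d>0)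
... | a ∷ b ∷ c ∷ [] , sub , a≤x ∷ b≤x ∷ c≤x ∷ [] , _ = _ , refl ∷ sub , threeBelow x<z a≤x b≤x c≤x

excess>0 : ∀ {s} xs → Bad s → s ⊆ xs → 0 < excess xs
excess>0 []       (bad _) ()
excess>0 (z ∷ zs) b       (.z ∷ʳ sub)  = ≤-trans (excess>0 zs b sub) (m≤m+n _ _)
excess>0 (z ∷ zs) (bad b) (refl ∷ sub) = ≤-trans (excessAt>0 zs b sub) (m≤n+m _ _)

excess>0⁻ : ∀ xs → 0 < excess xs → ∃[ s ] s ⊆ xs × Bad s
excess>0⁻ (x ∷ xs) e>0 with 0<m+n (excess xs) e>0
... | inj₁ e>0′ = let s , sub , b = excess>0⁻ xs e>0′ in s , x ∷ʳ sub , b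
... | inj₂ a>0  = let s , sub , b = excessAt>0⁻ x xs a>0 in x ∷ s , refl ∷ sub , bad b

-- From the excess to the theorem

module _ {n} (w : Vec (Fin n) n) (w-perm : IsPerm w) {r} (r-reduced : IsReduced w r) where

  private
    l = oneLine w

  length-support : length (deduplicate _≟_ r) ≡ supportSize l
  length-support = length-deduplicate≡supportSize r l
    (All.map proj₁ (proj₁ (proj₁ r-reduced))) (letter⇔crossing w w-perm r-reduced)

  repVia≡ : repVia r ≡ inv l ∸ supportSize l
  repVia≡ = cong₂ _∸_ (length≡inv w w-perm r-reduced) length-support

  supportSize≤inv : supportSize l ≤ inv l
  supportSize≤inv = subst₂ _≤_ length-support (length≡inv w w-perm r-reduced) (length-deduplicate _≟_ r)

theorem3p2 : ∀ (n : ℕ) (w : Vec (Fin n) n) → IsPerm w →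
    ∀ (r : List ℕ) → IsReduced w r →
    (All (λ p → Avoids p w) Φ → repVia r ≡ count321-3412 w)
    × (¬ All (λ p → Avoids p w) Φ → repVia r < count321-3412 w)
theorem3p2 n w w-perm r r-reduced = avoiding , containing
  where
  l = oneLine w

  avoiding : All (λ p → Avoids p w) Φ → repVia r ≡ count321-3412 w
  avoiding avoids = begin
    repVia r ≡⟨ repVia≡ w w-perm r-reduced ⟩
    inv l ∸ supportSize l ≡⟨ cong (_∸ supportSize l) inv≡ ⟩
    count321-3412 w + supportSize l ∸ supportSize l ≡⟨ m+n∸n≡m (count321-3412 w) (supportSize l) ⟩
    count321-3412 w ∎
    where
    open ≡-Reasoning
    excess≡0 : excess l ≡ 0
    excess≡0 = n≤0⇒n≡0 (≮⇒≥ λ e>0 →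
      let s , s⊆l , b = excess>0⁻ l e>0
          t , t⊆s , φ = Bad⇒Φ b
          c≡0 , t~p   = All.lookupAny avoids φ
      in <⇒≢ (count>0 _ (⊆-trans t⊆s s⊆l) t~p) (sym c≡0))

    inv≡ : inv l ≡ count321-3412 w + supportSize l
    inv≡ = trans (sym (+-identityʳ (inv l)))
      (trans (cong (inv l +_) (sym excess≡0)) (sym (count-identity l)))

  containing : ¬ All (λ p → Avoids p w) Φ → repVia r < count321-3412 w
  containing ¬avoids = begin-strict
    repVia r ≡⟨ repVia≡ w w-perm r-reduced ⟩
    -- Truncated subtraction stays strict here because `supportSize l ≤ inv l`: a word has at least
    -- as many letters as distinct letters.
    inv l ∸ supportSize l <⟨ ∸-monoˡ-< inv< (supportSize≤inv w w-perm r-reduced) ⟩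
    count321-3412 w + supportSize l ∸ supportSize l ≡⟨ m+n∸n≡m (count321-3412 w) (supportSize l) ⟩
    count321-3412 w ∎
    where
    open ≤-Reasoning
    excess>0′ : 0 < excess l
    excess>0′ = ≰⇒> λ e≤0 → ¬avoids (All.tabulate λ {p} p∈Φ →
      n≤0⇒n≡0 (≮⇒≥ λ c>0 →
        let s , s⊆l , s~p = count>0⁻ (sameOrder p) l c>0
        in <⇒≱ (excess>0 l (Φ⇒Bad (lose p∈Φ s~p)) s⊆l) e≤0))

    inv< : inv l < count321-3412 w + supportSize l
    inv< = subst (inv l <_) (sym (count-identity l)) (m<m+n (inv l) excess>0′)
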